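{- Let $G$ be a finite, simple, connected graph with vertex cover number $\mathsf{vcn}$. Then: (1) $\mathsf{c}_{lazy}(G)\leq \left\lceil\frac{\mathsf{vcn}}{2}\right\rceil+1$; (2) $\mathsf{c}_{attack}(G)\leq \left\lceil\frac{\mathsf{vcn}}{2}\right\rceil+1$; (3) $\mathsf{c}_{active}(G)\leq \mathsf{vcn}$; (4) $\mathsf{c}_{surround}(G)\leq \mathsf{vcn}$; (5) $\mathsf{c}_{s}(G)\leq \mathsf{vcn}$ for any value of $s\in\mathbb{N}$; (6) for a (that is, any) strongly connected orientation $\overrightarrow{G}$ of $G$, $\mathsf{c}(\overrightarrow{G})\leq \mathsf{vcn}$.
   Context: Cops and Robber game: two players with perfect information play on a graph $G$. The cop player places each of $k$ cops on a vertex (several cops may share a vertex); then the robber player places one robber on a vertex. Then they alternate moves, cops first. In a cop move, each cop either moves to an adjacent vertex or stays; in a robber move, the robber either moves to an adjacent vertex or stays. The cops win if they have a strategy to capture the robber (some cop occupies the same vertex as the robber); the robber wins if it can evade capture indefinitely. The variants below differ only as described; in each, the corresponding number is the minimum number of cops having a winning strategy. - $\mathsf{c}_{lazy}(G)$ (Lazy): at most one cop moves in each cop move. - $\mathsf{c}_{attack}(G)$ (Cops and Attacking Robber): on the robber's turn, if there is a cop on a vertex adjacent to the robber, the robber can attack it (moving to its vertex) and eliminate it from the game; if several cops occupy the attacked vertex, only one is eliminated and the robber is captured by another cop there. - $\mathsf{c}_{active}(G)$ (Fully Active): in each cop move every cop must move to an adjacent vertex, and in each robber move the robber must move to an adjacent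 vertex. - $\mathsf{c}_{surround}(G)$ (Surrounding): a cop and the robber may occupy the same vertex, but the robber cannot end its turn by remaining at a vertex occupied by a cop; the cops win by surrounding the robber, i.e. when the robber is at $v$ and there is a cop on every vertex of the open neighbourhood $N(v)$. - $\mathsf{c}_s(G)$ (Cops and Fast Robber with speed $s$): in its move the robber may move along a path with at most $s$ edges containing no cop. - $\mathsf{c}(\overrightarrow{G})$: the Cops and Robber game is played on the directed graph $\overrightarrow{G}$, and players can move only along the orientation of the arcs. An orientation of $G$ assigns one direction to each edge of $G$. The vertex cover number of $G$ is the minimum size of a set $U\subseteq V(G)$ such that $V(G)\setminus U$ is independent.
   Formalization: Parts (3), (5) and (6) are stated for graphs with at least two vertices, because for the one-vertex graph vcn = 0 while one cop is needed to capture the robber, so those three bounds fail there. -}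

module Defs where

open import Data.Fin.Base using (Fin)
open import Data.Fin.Subset using (Subset; ∁; ∣_∣; _∈_)
open import Data.List.Base using (List; head; last; length)
open import Data.List.Relation.Unary.All using (All)
open import Data.List.Relation.Unary.Linked using (Linked)
open import Data.List.Relation.Unary.Unique.Propositional using (Unique)
open import Data.Maybe.Base using (just)
open import Data.Nat.Base using (ℕ; suc; _≤_)
open import Data.Product.Base using (∃; _×_; _,_)
open import Data.Sum.Base using (_⊎_)
open import Data.Vec.Functional using (Vector; removeAt)
open import Data.Vec.Functional.Relation.Binary.Pointwise using (Pointwise)
open import Level using (0ℓ)
open import Relation.Binary.Construct.Closure.Reflexive using (ReflClosure)
open import Relation.Binary.Construct.Closure.ReflexiveTransitive using (Star)
open import Relation.Binary.Construct.Union using (_∪_)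
open import Relation.Binary.Core using (Rel)
open import Relation.Binary.Definitions
  using (Symmetric; Irreflexive; Asymmetric; Decidable)
open import Relation.Binary.PropositionalEquality.Core using (_≡_; _≢_)
open import Relation.Nullary.Negation.Core using (¬_)
open import Relation.Unary using (Pred)

IsLeast : Pred ℕ 0ℓ → Pred ℕ 0ℓ
IsLeast P m = P m × (∀ k → P k → m ≤ k)

record Graph (n : ℕ) : Set₁ where
  infix 4 _~_
  field
    _~_    : Rel (Fin n) 0ℓ
    sym    : Symmetric _~_
    irrefl : Irreflexive _≡_ _~_
    _~?_   : Decidable _~_

module _ {n : ℕ} (G : Graph n) where
  open Graph G

  Connected : Set
  Connected = ∀ u v → Star _~_ u v

  Independent : Pred (Subset n) 0ℓ
  Independent S = ∀ {u v} → u ∈ S → v ∈ S → ¬ (u ~ v)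

  IsVertexCover : Pred (Subset n) 0ℓ
  IsVertexCover U = Independent (∁ U)

  IsVertexCoverNumber : Pred ℕ 0ℓ
  IsVertexCoverNumber = IsLeast λ k → ∃ λ U → IsVertexCover U × ∣ U ∣ ≡ k

  record Orientation : Set₁ where
    infix 4 _⟶_
    field
      _⟶_    : Rel (Fin n) 0ℓ
      edge   : ∀ {u v} → u ⟶ v → u ~ v
      orient : ∀ {u v} → u ~ v → (u ⟶ v) ⊎ (v ⟶ u)
      asym   : Asymmetric _⟶_

  StronglyConnected : Orientation → Set
  StronglyConnected O = ∀ u v → Star (Orientation._⟶_ O) u v

-- The number of cops is part of a position, since cops may be eliminated.
record Position (n : ℕ) : Set where
  constructor pos
  field
    {#cops} : ℕ
    cops    : Vector (Fin n) #cops
    robber  : Fin n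

Occupied : ∀ {n k} → Vector (Fin n) k → Pred (Fin n) 0ℓ
Occupied c v = ∃ λ i → c i ≡ v

record Game (n : ℕ) : Set₁ where
  field
    CopMove    : Rel (Position n) 0ℓ
    RobberMove : Rel (Position n) 0ℓ
    Won        : Pred (Position n) 0ℓ

module _ {n : ℕ} (Γ : Game n) where
  open Game Γ

  -- Inhabitants are winning strategies of the cops from a position, as
  -- well-founded trees: along every play the cops win after finitely many
  -- moves. A robber without a legal move has not thereby lost.
  mutual
    data CopTurn (p : Position n) : Set where
      won  : Won p → CopTurn p
      move : ∀ {q} → CopMove p q → RobberTurn q → CopTurn p

    data RobberTurn (p : Position n) : Set where
      won     : Won p → RobberTurn p
      respond : ∃ (RobberMove p) → (∀ {q} → RobberMove p q → CopTurn q) →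
                RobberTurn p

  CopsWinWith : Pred ℕ 0ℓ
  CopsWinWith k = ∃ λ (c : Vector (Fin n) k) → ∀ r → CopTurn (pos c r)

  IsCopNumber : Pred ℕ 0ℓ
  IsCopNumber = IsLeast CopsWinWith

  -- The first component is what makes the bound on the least number
  -- non-vacuous: some number of cops up to b wins. Classically the two
  -- together say that the cop number exists and is at most b.
  CopNumberAtMost : Pred ℕ 0ℓ
  CopNumberAtMost b =
    (∃ λ k → k ≤ b × CopsWinWith k) × (∀ c → IsCopNumber c → c ≤ b)

data CopsMoveBy {n} (R : ∀ {k} → Rel (Vector (Fin n) k) 0ℓ) :
                Rel (Position n) 0ℓ where
  moved : ∀ {k} {c c′ : Vector (Fin n) k} {r} →
          R c c′ → CopsMoveBy R (pos c r) (pos c′ r)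

data RobberMovesBy {n} (R : ∀ {k} → Vector (Fin n) k → Rel (Fin n) 0ℓ) :
                   Rel (Position n) 0ℓ where
  moved : ∀ {k} {c : Vector (Fin n) k} {r r′} →
          R c r r′ → RobberMovesBy R (pos c r) (pos c r′)

Captured : ∀ {n} → Pred (Position n) 0ℓ
Captured (pos c r) = Occupied c r

-- Every piece moves along R in each of its moves; staying put is possible
-- only where R is reflexive.
pursuit : ∀ {n} → Rel (Fin n) 0ℓ → Game n
pursuit R = record
  { CopMove    = CopsMoveBy (Pointwise R)
  ; RobberMove = RobberMovesBy (λ _ → R)
  ; Won        = Captured
  }

module _ {n : ℕ} (G : Graph n) where
  open Graph G

  Step : Rel (Fin n) 0ℓ
  Step = ReflClosure _~_

  LazyMove : ∀ {k} → Rel (Vector (Fin n) k) 0ℓ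
  LazyMove c c′ =
    Pointwise Step c c′ × (∀ i j → c i ≢ c′ i → c j ≢ c′ j → i ≡ j)

  lazy : Game n
  lazy = record (pursuit Step) { CopMove = CopsMoveBy LazyMove }

  -- If another cop stands on the attacked vertex, the resulting position
  -- satisfies Captured.
  data Attack : Rel (Position n) 0ℓ where
    attack : ∀ {k} {c : Vector (Fin n) (suc k)} {r} i →
             r ~ c i → Attack (pos c r) (pos (removeAt c i) (c i))

  attacking : Game n
  attacking = record (pursuit Step)
    { RobberMove = RobberMovesBy (λ _ → Step) ∪ Attack }

  active : Game n
  active = pursuit _~_

  Surrounded : Pred (Position n) 0ℓ
  Surrounded (pos c r) = ∀ v → r ~ v → Occupied c v

  surrounding : Game n
  surrounding = record (pursuit Step)
    { RobberMove = RobberMovesBy (λ c r r′ → Step r r′ × ¬ Occupied c r′)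
    ; Won        = Surrounded
    }

  IsPath : Fin n → Fin n → Pred (List (Fin n)) 0ℓ
  IsPath u v p =
    head p ≡ just u × last p ≡ just v × Linked _~_ p × Unique p

  -- A path with at most s edges has at most suc s vertices.
  FastMove : ℕ → ∀ {k} → Vector (Fin n) k → Rel (Fin n) 0ℓ
  FastMove s c r r′ = ∃ λ p →
    IsPath r r′ p × length p ≤ suc s × All (λ v → ¬ Occupied c v) p

  fast : ℕ → Game n
  fast s = record (pursuit Step) { RobberMove = RobberMovesBy (FastMove s) }

  directed : Orientation G → Game n
  directed O = pursuit (ReflClosure (Orientation._⟶_ O))

{-# OPTIONS --safe #-}
-- For the last four parts a cop is placed on every vertex of a minimum vertex
-- cover U, which leaves only neighbours of cops (or surrounded vertices) to the
-- robber.
--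
-- For the first two, consider the game in which the cops are lazy and the robber
-- attacks. As long as some closed neighbourhood N[v] contains two vertices of U
-- not yet dominated, station a guard at v. When this stops, each N[v] contains
-- at most one undominated vertex of U, so that a robber who avoids the vertices
-- dominated by guards never leaves some N[t]. A team walks to t: two cops, who
-- keep adjacent or together and thereby protect each other from attacks; or, if
-- the guards dominate U, a single cop, who can then only be attacked on a
-- dominated vertex. (A vertex is dominated when a guard is at or next to it.)
module Submission where

open import Defs
open import Data.Bool.Base using (true; false)
open import Data.Fin.Base using (Fin; zero; suc; punchOut)
open import Data.Fin.Properties using (_≟_; any?; punchIn-punchOut)
open import Data.Fin.Subset using (Subset; _∈_; _∉_; _⊂_; _-_; ∣_∣; Nonempty)
open import Data.Fin.Subset.Induction using (⊂-wellFounded)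
open import Data.Fin.Subset.Properties using (_∈?_; nonempty?; x∈p∧x≢y⇒x∈p-y;
  x∈p⇒p-x⊂p; x∈p⇒∣p-x∣<∣p∣; x∉p⇒x∈∁p; x∉∁p⇒x∈p; ⊂-trans)
open import Data.Nat.Base using (ℕ; zero; suc; _≤_; _+_; z≤n; s≤s; ⌈_/2⌉)
open import Data.Nat.Properties using (≤-refl; ≤-trans; +-comm; +-suc; +-monoʳ-≤;
  +-monoˡ-≤; m≤m+n; ⌈n/2⌉-mono; n≡⌈n+n/2⌉; n≡⌊n+n/2⌋; module ≤-Reasoning)
open import Data.Product.Base using (∃; _×_; _,_; proj₁; proj₂)
open import Data.Sum.Base using (_⊎_; inj₁; inj₂; [_,_]′)
open import Data.Vec.Base using ([]; _∷_; here; there)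
open import Data.Vec.Functional as Vector using (Vector; updateAt; removeAt)
open import Data.Vec.Functional.Properties using (updateAt-updates; updateAt-minimal)
open import Data.Vec.Functional.Relation.Binary.Pointwise using (Pointwise)
open import Function.Base using (const; _∘_; id)
open import Induction.WellFounded using (Acc; acc)
open import Level using (0ℓ)
open import Relation.Binary.Construct.Closure.Reflexive using (ReflClosure; refl; [_])
open import Relation.Binary.Construct.Closure.Reflexive.Properties as Refl using ()
open import Relation.Binary.Construct.Closure.ReflexiveTransitive using (Star; ε; _◅_)
open import Relation.Binary.Core using (Rel; _⇒_)
open import Relation.Binary.Definitions using (Decidable)
open import Relation.Binary.PropositionalEquality using (_≡_; _≢_; refl; sym; trans; cong; subst)
open import Relation.Nullary.Decidable using (Dec; yes; no; ¬?; _×-dec_; decidable-stable)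
open import Relation.Nullary.Negation using (¬_; contradiction)
open import Relation.Unary using (Pred)

-- Transfer of strategies between games, and small tools

-- The strategy tree is replayed move by move. `free` is there because `respond` demands a legal
-- robber move, and restricting the robber could leave none.
simulate : ∀ {n} (Γ Δ : Game n) → let module Γ = Game Γ; module Δ = Game Δ in
  Γ.CopMove ⇒ Δ.CopMove → Δ.RobberMove ⇒ Γ.RobberMove →
  (∀ p → ∃ (Δ.RobberMove p)) → (∀ {p} → Γ.Won p → Δ.Won p) →
  ∀ {p} → CopTurn Γ p → CopTurn Δ p
simulate Γ Δ cop robber free win = copTurn
  where
  mutual
    copTurn : ∀ {p} → CopTurn Γ p → CopTurn Δ p
    copTurn (won w)    = won (win w)
    copTurn (move m t) = move (cop m) (robberTurn t)

    robberTurn : ∀ {p} → RobberTurn Γ p → RobberTurn Δ p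
    robberTurn (won w)       = won (win w)
    robberTurn (respond _ f) = respond (free _) λ m → copTurn (f (robber m))

copNumberAtMost : ∀ {n} {Γ : Game n} {k b} → k ≤ b → CopsWinWith Γ k →
                  CopNumberAtMost Γ b
copNumberAtMost k≤b wins =
  (_ , k≤b , wins) , λ c (_ , least) → ≤-trans (least _ wins) k≤b

enumerate : ∀ {n} (U : Subset n) →
            ∃ λ (c : Vector (Fin n) ∣ U ∣) → ∀ {u} → u ∈ U → Occupied c u
enumerate [] = (λ ()) , λ ()
enumerate (false ∷ U) =
  let c , hit = enumerate U in
  suc ∘ c , λ { (there u∈U) → let i , eq = hit u∈U in i , cong suc eq }
enumerate (true ∷ U) =
  let c , hit = enumerate U in
  zero Vector.∷ (suc ∘ c) , λ
    { here → zero , refl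
    ; (there u∈U) → let i , eq = hit u∈U in suc i , cong suc eq
    }

module _ {A : Set} {R : Rel A 0ℓ} where

  first-step : ∀ {x y} → x ≢ y → Star R x y → ∃ λ z → R x z
  first-step x≢y ε       = contradiction refl x≢y
  first-step x≢y (e ◅ _) = _ , e

  last-step : ∀ {x y} → x ≢ y → Star R x y → ∃ λ z → R z y
  last-step x≢y ε        = contradiction refl x≢y
  last-step x≢y (e ◅ es) = go e es
    where
    go : ∀ {x y z} → R x y → Star R y z → ∃ λ w → R w z
    go e ε        = _ , e
    go _ (f ◅ es) = go f es

other : ∀ {n} → 2 ≤ n → (v : Fin n) → ∃ λ u → u ≢ v
other (s≤s (s≤s _)) zero    = suc zero , λ ()
other (s≤s (s≤s _)) (suc v) = zero , λ ()

module _ {n} (G : Graph n) where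
  open Graph G renaming (sym to ~-sym)

  step-sym : ∀ {u v} → Step G u v → Step G v u
  step-sym = Refl.sym ~-sym

  step? : Decidable (Step G)
  step? = Refl.dec _≟_ _~?_

  -- A cop on every vertex of the cover

  cover-neighbour : ∀ {U u v} → IsVertexCover G U → u ∉ U → u ~ v → v ∈ U
  cover-neighbour cover u∉U u~v =
    x∉∁p⇒x∈p λ v∈∁U → cover (x∉p⇒x∈∁p u∉U) v∈∁U u~v

  -- A robber outside `U` has all neighbours in `U`, so a cop stands on the one supplied by `into`
  -- and captures in the first cop move. No robber move ever occurs, so the active, fast and
  -- directed games are treated at once. `out` gives the other cops a legal move when `R` is not
  -- reflexive.
  occupy-cover-captures :
    ∀ (M : Rel (Position n) 0ℓ) (R : Rel (Fin n) 0ℓ) {U} → IsVertexCover G U →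
    (∀ v → ∃ λ w → R v w) → (∀ v → ∃ λ u → u ~ v × R u v) →
    CopsWinWith (record (pursuit R) { RobberMove = M }) ∣ U ∣
  occupy-cover-captures M R {U} cover out into = c , turn
    where
    c   = proj₁ (enumerate U)
    hit = proj₂ (enumerate U)

    turn : ∀ r → CopTurn _ (pos c r)
    turn r with r ∈? U
    ... | yes r∈U = won (hit r∈U)
    ... | no  r∉U with into r
    ...   | u , u~r , uRr with hit (cover-neighbour cover r∉U (~-sym u~r))
    ...     | i , refl = move (moved moves) (won (i , updateAt-updates i away))
      where
      away : Vector (Fin n) ∣ U ∣
      away j = proj₁ (out (c j))

      moves : Pointwise R c (updateAt away i (const r))
      moves j with j ≟ i
      ... | yes refl = subst (R (c j)) (sym (updateAt-updates j away)) uRr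
      ... | no  j≢i  = subst (R (c j)) (sym (updateAt-minimal j i away j≢i))
                             (proj₂ (out (c j)))

  occupied? : ∀ {k} (c : Vector (Fin n) k) v → Dec (Occupied c v)
  occupied? c v = any? λ i → c i ≟ v

  -- The cops stand still. The robber's turn must end off the cops' vertices, hence outside `U`,
  -- where all neighbours are occupied.
  occupy-cover-surrounds : ∀ {U} → IsVertexCover G U →
                           CopsWinWith (surrounding G) ∣ U ∣
  occupy-cover-surrounds {U} cover = c , turn
    where
    c   = proj₁ (enumerate U)
    hit = proj₂ (enumerate U)

    surrounded : ∀ {r} → r ∉ U → Surrounded G (pos c r)
    surrounded r∉U v r~v = hit (cover-neighbour cover r∉U r~v)

    turn : ∀ r → CopTurn (surrounding G) (pos c r)
    -- A free neighbour is the legal move that `respond` demands; if there is none, the robber is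
    -- already surrounded.
    turn r with any? (λ v → r ~? v ×-dec ¬? (occupied? c v))
    ... | no  stuck = won λ v r~v →
      decidable-stable (occupied? c v) λ ¬occ → stuck (v , r~v , ¬occ)
    ... | yes (v , r~v , ¬occ) = move (moved λ _ → refl)
      (respond (_ , moved ([ r~v ] , ¬occ))
               λ { (moved (_ , ¬occ′)) → won (surrounded (¬occ′ ∘ hit)) })

  -- Lazy cops against an attacking robber

  lazyAttacking : Game n
  lazyAttacking = record (attacking G) { CopMove = CopsMoveBy (LazyMove G) }

  lazyAttacking⇒lazy : ∀ {k} → CopsWinWith lazyAttacking k → CopsWinWith (lazy G) k
  lazyAttacking⇒lazy (c , wins) = c , λ r →
    simulate lazyAttacking (lazy G) id inj₁ (λ _ → _ , moved refl) id (wins r)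

  lazyAttacking⇒attacking : ∀ {k} → CopsWinWith lazyAttacking k →
                            CopsWinWith (attacking G) k
  lazyAttacking⇒attacking (c , wins) = c , λ r →
    simulate lazyAttacking (attacking G) (λ { (moved (step , _)) → moved step }) id
      (λ _ → _ , inj₁ (moved refl)) id (wins r)

  lazyMove : ∀ {k} {c c′ : Vector (Fin n) k} i → Step G (c i) (c′ i) →
             (∀ j → j ≢ i → c j ≡ c′ j) → LazyMove G c c′
  lazyMove {c = c} {c′} i step rest = steps , λ j k j-moves k-moves →
    trans (only j j-moves) (sym (only k k-moves))
    where
    steps : Pointwise (Step G) c c′
    steps j with j ≟ i
    ... | yes refl = step
    ... | no  j≢i  = subst (Step G (c j)) (rest j j≢i) refl

    only : ∀ j → c j ≢ c′ j → j ≡ i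
    only j moves = decidable-stable (j ≟ i) (moves ∘ rest j)

  Dominated : ∀ {k} → Vector (Fin n) k → Pred (Fin n) 0ℓ
  Dominated c v = ∃ λ i → Step G (c i) v

  dominated? : ∀ {k} (c : Vector (Fin n) k) v → Dec (Dominated c v)
  dominated? c v = any? λ i → step? (c i) v

  capture : ∀ {k} {c : Vector (Fin n) k} {r} → Dominated c r →
            CopTurn lazyAttacking (pos c r)
  capture {c = c} {r} (i , step) =
    move (moved (lazyMove i (subst (Step G (c i)) (sym at-i) step)
                            λ j j≢i → sym (updateAt-minimal j i c j≢i)))
         (won (i , at-i))
    where
    at-i : updateAt c i (const r) i ≡ r
    at-i = updateAt-updates i c

  -- `i ≢ j` compares cops, not vertices, so cops sharing a vertex protect each other.
  Protected : ∀ {k} → Vector (Fin n) k → Fin n → Set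
  Protected c r = ∀ i → r ~ c i → ∃ λ j → i ≢ j × Step G (c j) (c i)

  -- An attack on cop `i` brings the robber to `c i`, within one step of a surviving cop `j`, which
  -- captures it.
  protected-robberTurn : ∀ {k} {c : Vector (Fin n) k} {r} → Protected c r →
    (∀ {r′} → Step G r r′ → CopTurn lazyAttacking (pos c r′)) →
    RobberTurn lazyAttacking (pos c r)
  protected-robberTurn {c = c} {r} protected chase =
    respond (_ , inj₁ (moved refl)) λ
      { (inj₁ (moved step))    → chase step
      ; (inj₂ (attack i r~ci)) → retaliate i (protected i r~ci)
      }
    where
    retaliate : ∀ {k} {c : Vector (Fin n) (suc k)} i →
                (∃ λ j → i ≢ j × Step G (c j) (c i)) →
                CopTurn lazyAttacking (pos (removeAt c i) (c i))
    retaliate {c = c} i (j , i≢j , step) = capture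
      (punchOut i≢j ,
       subst (λ x → Step G (c x) (c i)) (sym (punchIn-punchOut i≢j)) step)

  -- Guards and traps

  -- The construction deletes two vertices of `U` for each guard, and `rest` is the remainder, hence
  -- `size`. A guard may dominate more than these two, so the alternatives in `covers` can overlap.
  record Guarding (U : Subset n) : Set where
    field
      {#guards} : ℕ
      guards    : Vector (Fin n) #guards
      rest      : Subset n
      covers    : ∀ {u} → u ∈ U → Dominated guards u ⊎ u ∈ rest
      packed    : ∀ {v u w} → u ∈ rest → w ∈ rest →
                  Step G v u → Step G v w → u ≡ w
      size      : #guards + #guards + ∣ rest ∣ ≤ ∣ U ∣

  guarding : ∀ U → Guarding U
  guarding U = go U (⊂-wellFounded U)
    where
    go : ∀ U → Acc _⊂_ U → Guarding U
    go U (acc rec) with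
      any? (λ v → any? λ u → any? λ w → u ∈? U ×-dec w ∈? U ×-dec
                  step? v u ×-dec step? v w ×-dec ¬? (u ≟ w))
    ... | no  packed = record
      { #guards = 0
      ; guards  = λ ()
      ; rest    = U
      ; covers  = inj₂
      ; packed  = λ {v} {u} {w} u∈U w∈U vu vw → decidable-stable (u ≟ w) λ u≢w →
                   packed (v , u , w , u∈U , w∈U , vu , vw , u≢w)
      ; size    = ≤-refl
      }
    ... | yes (v , u , w , u∈U , w∈U , vu , vw , u≢w) = record
      { guards = v Vector.∷ guards
      ; rest   = rest
      ; covers = covers′
      ; packed = packed
      -- The new guard adds two on the left, paid for by deleting `u` and `w`.
      ; size   = subst (_≤ ∣ U ∣) (cong (λ x → suc x + ∣ rest ∣)
                                        (sym (+-suc #guards #guards)))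
                   (≤-trans (s≤s (s≤s size))
                     (≤-trans (s≤s (x∈p⇒∣p-x∣<∣p∣ w∈U-u)) (x∈p⇒∣p-x∣<∣p∣ u∈U)))
      }
      where
      w∈U-u : w ∈ U - u
      w∈U-u = x∈p∧x≢y⇒x∈p-y w∈U (u≢w ∘ sym)

      open Guarding (go (U - u - w) (rec (⊂-trans (x∈p⇒p-x⊂p w∈U-u) (x∈p⇒p-x⊂p u∈U))))

      covers′ : ∀ {x} → x ∈ U → Dominated (v Vector.∷ guards) x ⊎ x ∈ rest
      covers′ {x} x∈U with x ≟ u | x ≟ w
      ... | yes refl | _        = inj₁ (zero , vu)
      ... | no  _    | yes refl = inj₁ (zero , vw)
      ... | no  x≢u  | no  x≢w  with covers (x∈p∧x≢y⇒x∈p-y (x∈p∧x≢y⇒x∈p-y x∈U x≢u) x≢w)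
      ...   | inj₁ (i , step) = inj₁ (suc i , step)
      ...   | inj₂ x∈rest     = inj₂ x∈rest

  Trap : ∀ {k} → Vector (Fin n) k → Fin n → Set
  Trap d t = ∀ {r r′} → ¬ Dominated d r → Step G t r → Step G r r′ →
             Dominated d r′ ⊎ Step G t r′

  module _ {U : Subset n} (cover : IsVertexCover G U) (γ : Guarding U) where
    open Guarding γ

    -- If some `u` in `rest` is near `r`, an undominated `x` next to `u` is outside `U` by `packed`,
    -- so its neighbours lie in `U`: each is dominated or, by `packed` at `x`, equal to `u`. If
    -- there is no such `u`, then `r` is outside `U` and all its neighbours are dominated, so `r`
    -- itself is the centre of the trap.
    trapped : ∀ r → ¬ Dominated guards r → ∃ λ t → Trap guards t × Step G t r
    trapped r ¬dom with any? (λ u → u ∈? rest ×-dec step? u r)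
    ... | yes (u , u∈rest , ur) = u , trap , ur
      where
      trap : Trap guards u
      trap ¬dom ux refl = inj₂ ux
      trap ¬dom refl [ u~y ] = inj₂ [ u~y ]
      trap {x} ¬dom [ u~x ] [ x~y ] with covers (cover-neighbour cover x∉U x~y)
        where
        x∉U : x ∉ U
        x∉U x∈U with covers x∈U
        ... | inj₁ dom    = ¬dom dom
        ... | inj₂ x∈rest = irrefl (packed u∈rest x∈rest refl [ u~x ]) u~x
      ... | inj₁ dom    = inj₁ dom
      ... | inj₂ y∈rest = inj₂ (subst (Step G u)
              (packed u∈rest y∈rest [ ~-sym u~x ] [ x~y ]) refl)
    ... | no ¬near = r , trap , refl
      where
      r∉U : r ∉ U
      r∉U r∈U = [ ¬dom , (λ r∈rest → ¬near (r , r∈rest , refl)) ]′ (covers r∈U)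

      trap : Trap guards r
      trap _    refl    xy = inj₂ xy
      trap ¬dom [ r~x ] _  with covers (cover-neighbour cover r∉U r~x)
      ... | inj₁ dom    = contradiction dom ¬dom
      ... | inj₂ x∈rest = contradiction (_ , x∈rest , [ ~-sym r~x ]) ¬near

  -- The team's walk to the trap

  module _ {k} {d : Vector (Fin n) k} where

    chase-trapped : ∀ {l} {c : Vector (Fin n) l} {t r} → Trap d t →
      (∀ {v} → Dominated d v → Dominated c v) →
      ¬ Dominated d r → Step G t r → Protected c r →
      (∀ {r′} → ¬ Dominated d r′ → Step G t r′ → CopTurn lazyAttacking (pos c r′)) →
      RobberTurn lazyAttacking (pos c r)
    chase-trapped {c = c} {t} {r} trap widen ¬dom tr protected chase =
      protected-robberTurn protected turn
      where
      turn : ∀ {r′} → Step G r r′ → CopTurn lazyAttacking (pos c r′)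
      turn {r′} rr′ with dominated? d r′
      ... | yes dom   = capture (widen dom)
      ... | no  ¬dom′ with trap ¬dom tr rr′
      ...   | inj₁ dom = contradiction dom ¬dom′
      ...   | inj₂ tr′ = chase ¬dom′ tr′

    -- An undominated robber is outside `U`, so it can attack the walker only on a vertex of `U`,
    -- which a guard dominates. Guards are safe, as a robber next to one would be dominated.
    walk-alone : ∀ {U} → IsVertexCover G U → (∀ {u} → u ∈ U → Dominated d u) →
      ∀ {a t r} → Trap d t → Star _~_ a t → ¬ Dominated d r → Step G t r →
      CopTurn lazyAttacking (pos (a Vector.∷ d) r)
    -- The walker is at `t`, and the trap has kept the robber within one step of it.
    walk-alone cover U-dom trap ε ¬dom tr = capture (zero , tr)
    walk-alone cover U-dom {r = r} trap (_◅_ {j = b} a~b path) ¬dom tr =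
      move (moved (lazyMove zero [ a~b ] λ { zero 0≢0 → contradiction refl 0≢0
                                           ; (suc _) _ → refl }))
           (chase-trapped trap (λ (i , s) → suc i , s) ¬dom tr protected
                          (walk-alone cover U-dom trap path))
      where
      protected : Protected (b Vector.∷ d) r
      protected zero r~b with U-dom (cover-neighbour cover (¬dom ∘ U-dom) r~b)
      ... | j , s = suc j , (λ ()) , s
      protected (suc i) r~di = contradiction (i , [ ~-sym r~di ]) ¬dom

    pair-protected : ∀ {a b r} → Step G a b → ¬ Dominated d r →
                     Protected (a Vector.∷ (b Vector.∷ d)) r
    pair-protected ab ¬dom zero          _    = suc zero , (λ ()) , step-sym ab
    pair-protected ab ¬dom (suc zero)    _    = zero , (λ ()) , ab
    pair-protected ab ¬dom (suc (suc i)) r~di =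
      contradiction (i , [ ~-sym r~di ]) ¬dom

    -- Crossing an edge takes two rounds, one lazy move each: the pair is adjacent after the first
    -- and together after the second, hence protected in both robber turns.
    walk-in-pair : ∀ {a t r} → Trap d t → Star _~_ a t →
      ¬ Dominated d r → Step G t r →
      CopTurn lazyAttacking (pos (a Vector.∷ (a Vector.∷ d)) r)
    walk-in-pair trap ε ¬dom tr = capture (zero , tr)
    walk-in-pair trap (a~b ◅ path) ¬dom tr =
      move (moved (lazyMove zero [ a~b ] λ { zero 0≢0 → contradiction refl 0≢0
                                           ; (suc _) _ → refl }))
      (chase-trapped trap widen ¬dom tr
        (pair-protected [ ~-sym a~b ] ¬dom)
        λ ¬dom tr →
          move (moved (lazyMove (suc zero) [ a~b ]
                 λ { zero _ → refl
                   ; (suc zero) 1≢1 → contradiction refl 1≢1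
                   ; (suc (suc _)) _ → refl }))
          (chase-trapped trap widen ¬dom tr
            (pair-protected refl ¬dom)
            (walk-in-pair trap path)))
      where
      widen : ∀ {x y v} → Dominated d v → Dominated (x Vector.∷ (y Vector.∷ d)) v
      widen (i , s) = suc (suc i) , s

  -- Counting the cops

  -- The team starts at `a`. With g guards, a nonempty `rest` gives 2g + 1 ≤ `∣ U ∣`, and the extra
  -- vertex pays for the second walker. If `rest` is empty, 2g ≤ `∣ U ∣` and one walker suffices.
  lazyAttacking-bound′ : Connected G → Fin n → ∀ {U} → IsVertexCover G U →
    ∃ λ k → k ≤ ⌈ ∣ U ∣ /2⌉ + 1 × CopsWinWith lazyAttacking k
  lazyAttacking-bound′ connected a {U} cover = station (nonempty? rest)
    where
    γ = guarding U
    open Guarding γ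

    station : Dec (Nonempty rest) →
              ∃ λ k → k ≤ ⌈ ∣ U ∣ /2⌉ + 1 × CopsWinWith lazyAttacking k
    station (yes (_ , u∈rest)) =
      2 + #guards , bound , a Vector.∷ (a Vector.∷ guards) , turn
      where
      open ≤-Reasoning

      bound : 2 + #guards ≤ ⌈ ∣ U ∣ /2⌉ + 1
      bound = begin
        2 + #guards
          ≡⟨ +-comm 1 (1 + #guards) ⟩
        1 + #guards + 1
          -- `⌈ 1 + m /2⌉` computes to `1 + ⌊ m /2⌋`, hence the floor lemma.
          ≡⟨ cong (λ h → 1 + h + 1) (n≡⌊n+n/2⌋ #guards) ⟩
        ⌈ 1 + (#guards + #guards) /2⌉ + 1
          ≡⟨ cong (λ k → ⌈ k /2⌉ + 1) (+-comm 1 (#guards + #guards)) ⟩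
        ⌈ #guards + #guards + 1 /2⌉ + 1
          ≤⟨ +-monoˡ-≤ 1 (⌈n/2⌉-mono (+-monoʳ-≤ (#guards + #guards) 1≤∣rest∣)) ⟩
        ⌈ #guards + #guards + ∣ rest ∣ /2⌉ + 1
          ≤⟨ +-monoˡ-≤ 1 (⌈n/2⌉-mono size) ⟩
        ⌈ ∣ U ∣ /2⌉ + 1 ∎
        where
        1≤∣rest∣ : 1 ≤ ∣ rest ∣
        1≤∣rest∣ = ≤-trans (s≤s z≤n) (x∈p⇒∣p-x∣<∣p∣ u∈rest)

      turn : ∀ r → CopTurn lazyAttacking (pos (a Vector.∷ (a Vector.∷ guards)) r)
      turn r with dominated? guards r
      ... | yes (i , s) = capture (suc (suc i) , s)
      ... | no  ¬dom    with trapped cover γ r ¬dom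
      ...   | t , trap , tr = walk-in-pair trap (connected a t) ¬dom tr
    station (no empty) = 1 + #guards , bound , a Vector.∷ guards , turn
      where
      open ≤-Reasoning

      bound : 1 + #guards ≤ ⌈ ∣ U ∣ /2⌉ + 1
      bound = begin
        1 + #guards
          ≡⟨ +-comm 1 #guards ⟩
        #guards + 1
          ≡⟨ cong (_+ 1) (n≡⌈n+n/2⌉ #guards) ⟩
        ⌈ #guards + #guards /2⌉ + 1
          ≤⟨ +-monoˡ-≤ 1 (⌈n/2⌉-mono (≤-trans (m≤m+n _ _) size)) ⟩
        ⌈ ∣ U ∣ /2⌉ + 1 ∎

      dominates : ∀ {u} → u ∈ U → Dominated guards u
      dominates u∈U =
        [ id , (λ u∈rest → contradiction (_ , u∈rest) empty) ]′ (covers u∈U)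

      turn : ∀ r → CopTurn lazyAttacking (pos (a Vector.∷ guards) r)
      turn r with dominated? guards r
      ... | yes (i , s) = capture (suc i , s)
      ... | no  ¬dom    with trapped cover γ r ¬dom
      ...   | t , trap , tr = walk-alone cover dominates trap (connected a t) ¬dom tr

lazyAttacking-bound : ∀ {n} (G : Graph n) → Connected G →
  ∀ {U} → IsVertexCover G U →
  ∃ λ k → k ≤ ⌈ ∣ U ∣ /2⌉ + 1 × CopsWinWith (lazyAttacking G) k
lazyAttacking-bound {zero}  G _         _     = 0 , z≤n , (λ ()) , λ ()
lazyAttacking-bound {suc n} G connected cover =
  lazyAttacking-bound′ G connected zero cover

theorem7 : ∀ {n} (G : Graph n) → Connected G →
    ∀ vcn → IsVertexCoverNumber G vcn →
    CopNumberAtMost (lazy G) (⌈ vcn /2⌉ + 1) ×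
    CopNumberAtMost (attacking G) (⌈ vcn /2⌉ + 1) ×
    (2 ≤ n → CopNumberAtMost (active G) vcn) ×
    CopNumberAtMost (surrounding G) vcn ×
    (2 ≤ n → ∀ s → CopNumberAtMost (fast G s) vcn) ×
    (2 ≤ n → ∀ O → StronglyConnected G O → CopNumberAtMost (directed G O) vcn)
theorem7 {n} G connected vcn ((U , cover , refl) , _) =
  let k , k≤b , wins = lazyAttacking-bound G connected cover in
  copNumberAtMost k≤b (lazyAttacking⇒lazy G wins) ,
  copNumberAtMost k≤b (lazyAttacking⇒attacking G wins) ,
  (λ 2≤n → copNumberAtMost ≤-refl
    (occupy-cover-captures G _ _~_ cover (leave 2≤n)
      λ v → let u , v~u = leave 2≤n v in u , ~-sym v~u , ~-sym v~u)) ,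
  copNumberAtMost ≤-refl (occupy-cover-surrounds G cover) ,
  (λ 2≤n s → copNumberAtMost ≤-refl
    (occupy-cover-captures G _ (Step G) cover (λ v → v , refl)
      λ v → let u , v~u = leave 2≤n v in u , ~-sym v~u , [ ~-sym v~u ])) ,
  λ 2≤n O strong → copNumberAtMost ≤-refl
    (occupy-cover-captures G _ (ReflClosure (Orientation._⟶_ O)) cover (λ v → v , refl)
      λ v → let x , x≢v = other 2≤n v
                -- The capturing cop must enter `v` along an arc, so the path runs towards `v` and
                -- its last arc is taken.
                u , u⟶v = last-step x≢v (strong x v)
            in u , Orientation.edge O u⟶v , [ u⟶v ])
  where
  open Graph G renaming (sym to ~-sym)

  -- On a single vertex `vcn` is 0 and no cop is there to capture; a second vertex gives every
  -- vertex a neighbour.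
  leave : 2 ≤ n → ∀ v → ∃ λ u → v ~ u
  leave 2≤n v = let u , u≢v = other 2≤n v in
    first-step (u≢v ∘ sym) (connected v u)
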